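{- Let $H$ be a digraph (possibly with loops) and let $D$ be an $H$-colored semicomplete digraph in which every directed $3$-cycle is an $H$-cycle. If $k \geq 2$, then $D$ has a $(k,H)$-kernel.
   Context: All digraphs are finite. A digraph is semicomplete if every two distinct vertices are joined by at least one arc. $D$ has no loops and comes with a map $\rho: A(D)\to V(H)$. For a walk $W=(x_0,\ldots,x_n)$ in $D$, there is an obstruction on $x_i$ if $(\rho(x_{i-1},x_i),\rho(x_i,x_{i+1})) \notin A(H)$; for an open walk this is considered at internal vertices $x_i$, $1\le i\le n-1$, for a closed walk at all $i\in\{0,\ldots,n-1\}$ with indices modulo $n$. $O_H(W)$ is the set of indices with an obstruction; the $H$-length is $l_H(W)=|O_H(W)|+1$ for open $W$ and $|O_H(W)|$ for closed $W$. An $H$-cycle is a directed cycle with no obstructions (the consecutive colours of its arcs, cyclically, form a closed walk in $H$). A $(k,H)$-kernel ($k\ge2$) is a set $S\subseteq V(D)$ such that for every two distinct $u,v\in S$ every directed $uv$-path in $D$ has $H$-length at least $k$, and for every $x\in V(D)\setminus S$ there is a directed path from $x$ to a vertex of $S$ of $H$-length at most $k-1$. -}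

module Defs where

open import Data.Bool using (Bool; T; not; _∧_; if_then_else_)
open import Data.Fin using (Fin; zero; suc; inject₁; fromℕ; _≟_)
open import Data.Fin.Subset using (Subset; _∈_; _∉_; ∣_∣; Empty)
open import Data.Nat using (ℕ; zero; suc; _≤_; _∸_; NonZero)
open import Data.Product using (_×_; ∃-syntax)
open import Data.Sum using (_⊎_)
open import Data.Vec using ([]; _∷_; tabulate)
open import Function using (_∘_)
open import Function.Definitions using (Injective)
open import Relation.Binary.PropositionalEquality using (_≡_; _≢_)
open import Relation.Nullary using (¬_; Dec; does)

-- A Boolean adjacency matrix makes `Arc` proof-irrelevant, so the arcs form a
-- set of ordered pairs: there are no parallel arcs.
record Digraph : Set where
  field
    order : ℕ
    adj   : Fin order → Fin order → Bool

  V : Set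
  V = Fin order

  Arc : V → V → Set
  Arc u v = T (adj u v)

open Digraph public

Loopless : Digraph → Set
Loopless D = ∀ u → ¬ Arc D u u

Semicomplete : Digraph → Set
Semicomplete D = ∀ u v → u ≢ v → Arc D u v ⊎ Arc D v u

-- The walk (x₀ , … , xₙ), with n arcs.
record Walk (D : Digraph) (n : ℕ) : Set where
  field
    vertex : Fin (suc n) → V D
    arc    : ∀ i → Arc D (vertex (inject₁ i)) (vertex (suc i))

  start end : V D
  start = vertex zero
  end   = vertex (fromℕ n)

  Closed : Set
  Closed = start ≡ end

  closed? : Dec Closed
  closed? = start ≟ end

open Walk public

record IsPath {D n} (W : Walk D n) (u v : V D) : Set where
  field
    start≡   : start W ≡ u
    end≡     : end W ≡ v
    distinct : Injective _≡_ _≡_ (vertex W)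

record IsCycle {D n} (W : Walk D n) : Set where
  field
    nonempty : NonZero n
    closed   : Closed W
    distinct : Injective _≡_ _≡_ (vertex W ∘ inject₁)

record Colouring (D H : Digraph) : Set where
  field
    ρ : ∀ u v → Arc D u v → V H

module _ {D H : Digraph} (C : Colouring D H) where
  open Colouring C

  arcColour : ∀ {n} → Walk D n → Fin n → V H
  arcColour W i = ρ (vertex W (inject₁ i)) (vertex W (suc i)) (arc W i)

  -- O_H(W) ⊆ {0 , … , n-1}. Index 0 can carry an obstruction only if W is
  -- closed, in which case the arc preceding x₀ is the last arc of W.
  obstructions : ∀ {n} → Walk D n → Subset n
  obstructions {zero}  W = []
  obstructions {suc m} W =
    (does (closed? W) ∧ obstructed (fromℕ m) zero)
      ∷ tabulate (λ i → obstructed (inject₁ i) (suc i))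
    where
    obstructed : Fin (suc m) → Fin (suc m) → Bool
    obstructed i j = not (adj H (arcColour W i) (arcColour W j))

  hLength : ∀ {n} → Walk D n → ℕ
  hLength W =
    if does (closed? W) then ∣ obstructions W ∣ else suc ∣ obstructions W ∣

  IsHCycle : ∀ {n} → Walk D n → Set
  IsHCycle W = IsCycle W × Empty (obstructions W)

  record IsKernel (k : ℕ) (S : Subset (order D)) : Set where
    field
      independent : ∀ {u v} → u ∈ S → v ∈ S → u ≢ v →
                    ∀ {n} (W : Walk D n) → IsPath W u v → k ≤ hLength W
      absorbent   : ∀ {x} → x ∉ S →
                    ∃[ v ] v ∈ S × (∃[ n ] ∃[ W ] IsPath {n = n} W x v × hLength W ≤ k ∸ 1)

{-# OPTIONS --safe #-}
-- Arcs have H-length 1 < k, so a kernel has at most one vertex, and it is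
-- enough to find v such that every other x reaches v without obstruction. A
-- king v does this: x → v, or else x → w → v and, by semicompleteness, v → x,
-- so that x → w → v is part of a directed 3-cycle and hence unobstructed.
module Submission where

open import Defs
open import Data.Bool using (not; false)
open import Data.Bool.Properties using (T?; ¬-not)
open import Data.Fin using (Fin; zero; suc; _≟_)
open import Data.Fin.Properties using (any?)
open import Data.Fin.Subset using (⁅_⁆; _∈_)
open import Data.Fin.Subset.Properties using (x∈⁅x⁆; x∈⁅y⁆⇒x≡y)
open import Data.Nat using (zero; suc; _≤_; _∸_)
open import Data.Nat.Properties using (≤-trans; ≤-reflexive; ∸-monoˡ-≤)
open import Data.Product using (_×_; _,_; ∃-syntax)
open import Data.Sum using (_⊎_; inj₁; inj₂; fromInj₂)
open import Data.Vec using (lookup; tabulate; []; _∷_)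
open import Data.Vec.Properties using (lookup∘tabulate; lookup⇒[]=)
open import Data.Vec.Relation.Unary.All using ([]; _∷_)
open import Data.Vec.Relation.Unary.AllPairs using ([]; _∷_)
open import Data.Vec.Relation.Unary.Unique.Propositional using (Unique)
open import Data.Vec.Relation.Unary.Unique.Propositional.Properties
  using (lookup-injective)
open import Function using (_∘_)
open import Function.Definitions using (Injective)
open import Relation.Binary.Core using (Rel)
open import Relation.Binary.Definitions using (Decidable)
open import Relation.Binary.PropositionalEquality
  using (_≡_; _≢_; refl; sym; trans; cong; subst)
open import Relation.Nullary using (yes; no; contradiction)
open import Relation.Nullary.Decidable using (dec-false; _×-dec_; _⊎-dec_)

-- A king in the reversed sense: the other vertices reach `v` within two steps, matching the
-- direction of absorption.
King : ∀ {n ℓ} → Rel (Fin n) ℓ → Fin n → Set ℓ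
King E v = ∀ u → u ≢ v → E u v ⊎ ∃[ w ] E u w × E w v

-- Landau's induction: if v is a king of the digraph without vertex 0 and 0
-- does not reach v in two steps, then v and all its in-neighbours point to 0,
-- so 0 is a king.
∃-king : ∀ {n ℓ} {E : Rel (Fin (suc n)) ℓ} → Decidable E →
         (∀ u v → u ≢ v → E u v ⊎ E v u) → ∃[ v ] King E v
∃-king {zero} E? total = zero , λ { zero 0≢0 → contradiction refl 0≢0 }
∃-king {suc n} {E = E} E? total
  with ∃-king {E = λ u v → E (suc u) (suc v)} (λ u v → E? (suc u) (suc v))
         (λ u v u≢v → total (suc u) (suc v) λ { refl → u≢v refl })
... | v , king
  with E? zero (suc v) ⊎-dec any? (λ w → E? zero w ×-dec E? w (suc v))
...   | yes zero⇒v = suc v , λ where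
        zero    _   → zero⇒v
        (suc u) u≢v → lift (king u (u≢v ∘ cong suc))
  where
  lift : ∀ {u} → E (suc u) (suc v) ⊎ ∃[ w ] E (suc u) (suc w) × E (suc w) (suc v) →
         E (suc u) (suc v) ⊎ ∃[ w ] E (suc u) w × E w (suc v)
  lift (inj₁ uv)           = inj₁ uv
  lift (inj₂ (w , uw , wv)) = inj₂ (suc w , uw , wv)
...   | no zero⇏v = zero , λ where
        zero    0≢0 → contradiction refl 0≢0
        (suc u) _   → absorbed u
  where
  v→0 : E (suc v) zero
  v→0 = fromInj₂ (λ 0v → contradiction (inj₁ 0v) zero⇏v) (total zero (suc v) λ ())

  in-neighbour→0 : ∀ {w} → E (suc w) (suc v) → E (suc w) zero
  in-neighbour→0 {w} wv =
    fromInj₂ (λ 0w → contradiction (inj₂ (suc w , 0w , wv)) zero⇏v)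
             (total zero (suc w) λ ())

  absorbed : ∀ u → E (suc u) zero ⊎ ∃[ w ] E (suc u) w × E w zero
  absorbed u with u ≟ v
  ... | yes refl = inj₁ v→0
  ... | no  u≢v with king u u≢v
  ...   | inj₁ uv            = inj₁ (in-neighbour→0 uv)
  ...   | inj₂ (w , uw , wv) = inj₂ (suc w , uw , in-neighbour→0 wv)

-- Replaces a case split on pairs of indices: for the short walks below, tabulating the vertex map
-- computes to an explicit vector.
tabulate-unique⇒injective : ∀ {a} {A : Set a} {n} {f : Fin n → A} →
                            Unique (tabulate f) → Injective _≡_ _≡_ f
tabulate-unique⇒injective {f = f} unique {i} {j} fi≡fj =
  lookup-injective unique i j
    (trans (lookup∘tabulate f i) (trans fi≡fj (sym (lookup∘tabulate f j))))

module _ {D : Digraph} where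

  walk₁ : ∀ {x y} → Arc D x y → Walk D 1
  walk₁ {x} {y} xy = record
    { vertex = lookup (x ∷ y ∷ [])
    ; arc    = λ { zero → xy }
    }

  walk₂ : ∀ {x y z} → Arc D x y → Arc D y z → Walk D 2
  walk₂ {x} {y} {z} xy yz = record
    { vertex = lookup (x ∷ y ∷ z ∷ [])
    ; arc    = λ { zero → xy ; (suc zero) → yz }
    }

  triangle : ∀ {x y z} → Arc D x y → Arc D y z → Arc D z x → Walk D 3
  triangle {x} {y} {z} xy yz zx = record
    { vertex = lookup (x ∷ y ∷ z ∷ x ∷ [])
    ; arc    = λ { zero → xy ; (suc zero) → yz ; (suc (suc zero)) → zx }
    }

  module _ {x y z : V D} (x≢y : x ≢ y) (x≢z : x ≢ z) (y≢z : y ≢ z) where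

    -- Serves the path and the 3-cycle alike, since `inject₁` drops the repeated last vertex of
    -- `triangle`.
    unique₃ : Unique (x ∷ y ∷ z ∷ [])
    unique₃ = (x≢y ∷ x≢z ∷ []) ∷ (y≢z ∷ []) ∷ [] ∷ []

    walk₂-isPath : (xy : Arc D x y) (yz : Arc D y z) → IsPath (walk₂ xy yz) x z
    walk₂-isPath _ _ = record
      { start≡   = refl
      ; end≡     = refl
      ; distinct = tabulate-unique⇒injective unique₃
      }

    triangle-isCycle : (xy : Arc D x y) (yz : Arc D y z) (zx : Arc D z x) →
                       IsCycle (triangle xy yz zx)
    triangle-isCycle _ _ _ = record
      { nonempty = _
      ; closed   = refl
      ; distinct = tabulate-unique⇒injective unique₃
      }

  walk₁-isPath : ∀ {x y} → x ≢ y → (xy : Arc D x y) → IsPath (walk₁ xy) x y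
  walk₁-isPath x≢y _ = record
    { start≡   = refl
    ; end≡     = refl
    ; distinct = tabulate-unique⇒injective ((x≢y ∷ []) ∷ [] ∷ [])
    }

  module _ {H : Digraph} (C : Colouring D H) where
    open Colouring C

    hLength-walk₁ : ∀ {x y} → x ≢ y → (xy : Arc D x y) →
                    hLength C (walk₁ xy) ≡ 1
    hLength-walk₁ {x} {y} x≢y xy rewrite dec-false (x ≟ y) x≢y = refl

    hLength-walk₂ : ∀ {x y z} → x ≢ z → (xy : Arc D x y) (yz : Arc D y z) →
                    not (adj H (ρ x y xy) (ρ y z yz)) ≡ false →
                    hLength C (walk₂ xy yz) ≡ 1
    hLength-walk₂ {x} {z = z} x≢z xy yz unobstructed
      -- Openness removes the wrap-around obstruction at index 0, so only the one at `y` could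
      -- count.
      rewrite dec-false (x ≟ z) x≢z | unobstructed = refl

    king⇒kernel : Loopless D → Semicomplete D →
                  (∀ (W : Walk D 3) → IsCycle W → IsHCycle C W) →
                  ∀ {v} → King (Arc D) v → ∀ k → 2 ≤ k → IsKernel C k ⁅ v ⁆
    king⇒kernel loopless semicomplete 3-cycles {v} king k 2≤k = record
      { independent = λ u∈S w∈S u≢w → contradiction
          (trans (x∈⁅y⁆⇒x≡y v u∈S) (sym (x∈⁅y⁆⇒x≡y v w∈S))) u≢w
      ; absorbent   = λ {x} x∉S → v , x∈⁅x⁆ v ,
          absorb x λ x≡v → x∉S (subst (λ s → x ∈ ⁅ s ⁆) x≡v (x∈⁅x⁆ x))
      }
      where
      -- `King` does not say that the middle vertex differs from the two ends; looplessness does.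
      arc⇒≢ : ∀ {x y} → Arc D x y → x ≢ y
      arc⇒≢ {x} xy refl = loopless x xy

      short : ∀ {n} (W : Walk D n) → hLength C W ≡ 1 → hLength C W ≤ k ∸ 1
      -- From `2 ≤ k` comes `1 ≤ k ∸ 1`.
      short W eq = ≤-trans (≤-reflexive eq) (∸-monoˡ-≤ 1 2≤k)

      absorb : ∀ x → x ≢ v →
               ∃[ n ] ∃[ W ] IsPath {n = n} W x v × hLength C W ≤ k ∸ 1
      -- Semicompleteness gives either the arc from `x` to `v` outright or the arc `vx` that closes
      -- `x → w → v` into a triangle.
      absorb x x≢v with semicomplete x v x≢v | king x x≢v
      ... | inj₁ xv | _       = 1 , walk₁ xv , walk₁-isPath x≢v xv ,
                                short (walk₁ xv) (hLength-walk₁ x≢v xv)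
      ... | inj₂ _  | inj₁ xv = 1 , walk₁ xv , walk₁-isPath x≢v xv ,
                                short (walk₁ xv) (hLength-walk₁ x≢v xv)
      ... | inj₂ vx | inj₂ (w , xw , wv) =
        2 , walk₂ xw wv , walk₂-isPath (arc⇒≢ xw) x≢v (arc⇒≢ wv) xw wv ,
        short (walk₂ xw wv) (hLength-walk₂ x≢v xw wv unobstructed)
        where
        W : Walk D 3
        W = triangle xw wv vx

        unobstructed : not (adj H (ρ x w xw) (ρ w v wv)) ≡ false
        unobstructed
          with 3-cycles W (triangle-isCycle (arc⇒≢ xw) x≢v (arc⇒≢ wv) xw wv vx)
        ... | _ , empty = ¬-not λ obstructed →
          -- Index 1 of the triangle is `w`, where the same two arcs meet as inside the path.
          empty (suc zero , lookup⇒[]= (suc zero) (obstructions C W) obstructed)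

theorem7 : (H D : Digraph) (C : Colouring D H) →
    Loopless D → Semicomplete D →
    (∀ (W : Walk D 3) → IsCycle W → IsHCycle C W) →
    ∀ k → 2 ≤ k → ∃[ S ] IsKernel C k S
-- Without vertices there is no king, and the empty set is a kernel vacuously.
theorem7 H record { order = zero } C _ _ _ k _ =
  [] , record { independent = λ () ; absorbent = λ {} }
theorem7 H D@record { order = suc _ } C loopless semicomplete 3-cycles k 2≤k
  with ∃-king (λ u v → T? (adj D u v)) semicomplete
... | v , king = ⁅ v ⁆ ,
  king⇒kernel C loopless semicomplete 3-cycles king k 2≤k
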